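{- For any $\mathbb{T}$-gain digraph $\Phi=(D,\varphi)$, $\rho(\Phi)\le\Delta^+$.
   Context: A digraph $D=(V,\mathcal{A})$ has a finite vertex set $V=\{v_1,\dots,v_n\}$ and a set $\mathcal{A}$ of ordered pairs of distinct vertices, called arcs (no loops; at most one arc from $v_i$ to $v_j$ for each ordered pair; opposite arcs may both be present). The out-degree $\deg^+(v)$ is the number of arcs leaving $v$, and $\Delta^+=\max_i\deg^+(v_i)$. Let $\mathbb{T}=\{z\in\mathbb{C}:|z|=1\}$. A $\mathbb{T}$-gain digraph is a pair $\Phi=(D,\varphi)$ with $\varphi:\mathcal{A}\to\mathbb{T}$ an arbitrary function. Its gain adjacency matrix $A(\Phi)$ has entries $A(\Phi)_{ij}=\varphi(v_i,v_j)$ if $(v_i,v_j)\in\mathcal{A}$ and $0$ otherwise. $\rho(\Phi)$ is the spectral radius (maximum modulus of a complex eigenvalue) of $A(\Phi)$. -}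

module Defs where

open import Data.Nat using (ℕ; _⊔_) renaming (_≤_ to _≤ⁿ_)
import Data.Nat.Properties as ℕₚ
open import Data.Integer using (+_)
open import Data.Rational as ℚ using (ℚ; 0ℚ; 1ℚ; ½; ∣_∣; _/_; 1/_; Positive; NonZero; positive)
import Data.Rational.Properties as ℚₚ
open import Data.Rational.Solver using (module +-*-Solver)
open import Data.Fin using (Fin)
import Data.Fin.Subset as Subset
open import Data.Fin.Subset using (Subset; _∈_; _∉_)
open import Data.Fin.Subset.Properties using (_∈?_)
open import Data.Vec.Functional using (Vector; foldr)
open import Data.Product using (Σ; ∃; _×_; _,_; proj₁; proj₂)
open import Relation.Nullary using (¬_; yes; no)
open import Relation.Binary.PropositionalEquality using (_≡_; refl; sym; cong; cong₂; subst; module ≡-Reasoning)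

infix  4 _≈_ _≤_ _≈ᶜ_
infixl 6 _+_ _-_ _+ᶜ_
infixl 7 _*_ _*ᶜ_

-- Real numbers are Cauchy sequences of rationals; equality of reals is _≈_, not _≡_.

IsCauchy : (ℕ → ℚ) → Set
IsCauchy x = ∀ ε → 0ℚ ℚ.< ε → ∃ λ N → ∀ m n → N ≤ⁿ m → N ≤ⁿ n → ∣ x m ℚ.- x n ∣ ℚ.< ε

record ℝ : Set where
  constructor mkℝ
  field
    seq    : ℕ → ℚ
    cauchy : IsCauchy seq

open ℝ public

_≈_ : ℝ → ℝ → Set
x ≈ y = ∀ ε → 0ℚ ℚ.< ε → ∃ λ N → ∀ n → N ≤ⁿ n → ∣ seq x n ℚ.- seq y n ∣ ℚ.< ε

_≤_ : ℝ → ℝ → Set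
x ≤ y = ∀ ε → 0ℚ ℚ.< ε → ∃ λ N → ∀ n → N ≤ⁿ n → seq x n ℚ.≤ seq y n ℚ.+ ε

fromℚ : ℚ → ℝ
fromℚ q = mkℝ (λ _ → q) λ ε 0<ε → 0 , λ _ _ _ _ →
  subst (ℚ._< ε) (cong ∣_∣ (sym (ℚₚ.+-inverseʳ q))) 0<ε

fromℕ : ℕ → ℝ
fromℕ n = fromℚ (+ n / 1)

0ℝ 1ℝ : ℝ
0ℝ = fromℚ 0ℚ
1ℝ = fromℚ 1ℚ

private
  open +-*-Solver using (solve; _:+_; _:*_; :-_; _:-_; _:=_; con)

  half+half : ∀ ε → ε ℚ.* ½ ℚ.+ ε ℚ.* ½ ≡ ε
  half+half = solve 1 (λ e → e :* con ½ :+ e :* con ½ := e) refl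

  +-diff : ∀ a b c d → (a ℚ.+ b) ℚ.- (c ℚ.+ d) ≡ (a ℚ.- c) ℚ.+ (b ℚ.- d)
  +-diff = solve 4 (λ a b c d → (a :+ b) :- (c :+ d) := (a :- c) :+ (b :- d)) refl

  *-diff : ∀ a b c d → a ℚ.* b ℚ.- c ℚ.* d ≡ a ℚ.* (b ℚ.- d) ℚ.+ d ℚ.* (a ℚ.- c)
  *-diff = solve 4 (λ a b c d → a :* b :- c :* d := a :* (b :- d) :+ d :* (a :- c)) refl

  diff+ : ∀ a b → a ≡ (a ℚ.- b) ℚ.+ b
  diff+ = solve 2 (λ a b → a := (a :- b) :+ b) refl

  *-left-comm : ∀ a b c → a ℚ.* (b ℚ.* c) ≡ b ℚ.* (a ℚ.* c)
  *-left-comm = solve 3 (λ a b c → a :* (b :* c) := b :* (a :* c)) refl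

  0<half : ∀ {ε} → 0ℚ ℚ.< ε → 0ℚ ℚ.< ε ℚ.* ½
  0<half {ε} 0<ε = subst (ℚ._< ε ℚ.* ½) (ℚₚ.*-zeroˡ ½) (ℚₚ.*-monoˡ-<-pos ½ 0<ε)

  abstract
    +-cauchy : ∀ f g → IsCauchy f → IsCauchy g → IsCauchy (λ n → f n ℚ.+ g n)
    +-cauchy f g cf cg ε 0<ε with cf _ (0<half 0<ε) | cg _ (0<half 0<ε)
    ... | M , hf | N , hg = M ⊔ N , λ m n p q → begin-strict
      ∣ (f m ℚ.+ g m) ℚ.- (f n ℚ.+ g n) ∣
        ≡⟨ cong ∣_∣ (+-diff (f m) (g m) (f n) (g n)) ⟩
      ∣ (f m ℚ.- f n) ℚ.+ (g m ℚ.- g n) ∣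
        ≤⟨ ℚₚ.∣p+q∣≤∣p∣+∣q∣ (f m ℚ.- f n) (g m ℚ.- g n) ⟩
      ∣ f m ℚ.- f n ∣ ℚ.+ ∣ g m ℚ.- g n ∣
        <⟨ ℚₚ.+-mono-< (hf m n (ℕₚ.≤-trans (ℕₚ.m≤m⊔n M N) p) (ℕₚ.≤-trans (ℕₚ.m≤m⊔n M N) q))
                       (hg m n (ℕₚ.≤-trans (ℕₚ.m≤n⊔m M N) p) (ℕₚ.≤-trans (ℕₚ.m≤n⊔m M N) q)) ⟩
      ε ℚ.* ½ ℚ.+ ε ℚ.* ½
        ≡⟨ half+half ε ⟩
      ε ∎
      where open ℚₚ.≤-Reasoning

  abstract
    neg-cauchy : ∀ f → IsCauchy f → IsCauchy (λ n → ℚ.- f n)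
    neg-cauchy f cf ε 0<ε with cf ε 0<ε
    ... | N , h = N , λ m n p q → subst (ℚ._< ε) (flip-sign m n) (h m n p q)
      where
      open ≡-Reasoning
      flip-sign : ∀ m n → ∣ f m ℚ.- f n ∣ ≡ ∣ ℚ.- f m ℚ.- ℚ.- f n ∣
      flip-sign m n = begin
        ∣ f m ℚ.- f n ∣            ≡⟨ ℚₚ.∣-p∣≡∣p∣ (f m ℚ.- f n) ⟨
        ∣ ℚ.- (f m ℚ.- f n) ∣      ≡⟨ cong ∣_∣ (ℚₚ.neg-distrib-+ (f m) (ℚ.- f n)) ⟩
        ∣ ℚ.- f m ℚ.- ℚ.- f n ∣    ∎

  cauchy⇒bounded : ∀ {f} → IsCauchy f →
    ∃ λ B → 0ℚ ℚ.< B × ∃ λ N → ∀ n → N ≤ⁿ n → ∣ f n ∣ ℚ.≤ B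
  cauchy⇒bounded {f} cf with cf 1ℚ (ℚₚ.positive⁻¹ 1ℚ)
  ... | N , h = 1ℚ ℚ.+ ∣ f N ∣
              , ℚₚ.+-mono-<-≤ (ℚₚ.positive⁻¹ 1ℚ) (ℚₚ.0≤∣p∣ (f N))
              , N , bound
    where
    open ℚₚ.≤-Reasoning
    bound : ∀ n → N ≤ⁿ n → ∣ f n ∣ ℚ.≤ 1ℚ ℚ.+ ∣ f N ∣
    bound n p = begin
      ∣ f n ∣                          ≡⟨ cong ∣_∣ (diff+ (f n) (f N)) ⟩
      ∣ (f n ℚ.- f N) ℚ.+ f N ∣        ≤⟨ ℚₚ.∣p+q∣≤∣p∣+∣q∣ (f n ℚ.- f N) (f N) ⟩
      ∣ f n ℚ.- f N ∣ ℚ.+ ∣ f N ∣      ≤⟨ ℚₚ.+-monoˡ-≤ ∣ f N ∣ (ℚₚ.<⇒≤ (h n N p ℕₚ.≤-refl)) ⟩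
      1ℚ ℚ.+ ∣ f N ∣                   ∎

  split : ∀ {ε B} → 0ℚ ℚ.< ε → 0ℚ ℚ.< B → ∃ λ δ → 0ℚ ℚ.< δ × B ℚ.* δ ≡ ε
  split {ε} {B} 0<ε 0<B = ε ℚ.* 1/ B , 0<δ , Bδ≡ε
    where
    instance
      B-pos : Positive B
      B-pos = positive 0<B
      B-nonZero : NonZero B
      B-nonZero = ℚₚ.pos⇒nonZero B
      1/B-pos : Positive (1/ B)
      1/B-pos = ℚₚ.1/pos⇒pos B

    0<δ : 0ℚ ℚ.< ε ℚ.* 1/ B
    0<δ = subst (ℚ._< ε ℚ.* 1/ B) (ℚₚ.*-zeroˡ (1/ B)) (ℚₚ.*-monoˡ-<-pos (1/ B) 0<ε)

    open ≡-Reasoning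
    Bδ≡ε : B ℚ.* (ε ℚ.* 1/ B) ≡ ε
    Bδ≡ε = begin
      B ℚ.* (ε ℚ.* 1/ B)  ≡⟨ *-left-comm B ε (1/ B) ⟩
      ε ℚ.* (B ℚ.* 1/ B)  ≡⟨ cong (ε ℚ.*_) (ℚₚ.*-inverseʳ B) ⟩
      ε ℚ.* 1ℚ            ≡⟨ ℚₚ.*-identityʳ ε ⟩
      ε                   ∎

  *-≤-< : ∀ {a b c d} → 0ℚ ℚ.≤ c → a ℚ.≤ b → 0ℚ ℚ.< b → c ℚ.< d → a ℚ.* c ℚ.< b ℚ.* d
  *-≤-< {a} {b} {c} {d} 0≤c a≤b 0<b c<d = ℚₚ.≤-<-trans
    (ℚₚ.*-monoʳ-≤-nonNeg c {{ℚ.nonNegative 0≤c}} a≤b)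
    (ℚₚ.*-monoʳ-<-pos b {{positive 0<b}} c<d)

  *-close : ∀ a b c d {B C δ} → ∣ a ∣ ℚ.≤ B → 0ℚ ℚ.< B → ∣ d ∣ ℚ.≤ C → 0ℚ ℚ.< C →
            ∣ b ℚ.- d ∣ ℚ.< δ → ∣ a ℚ.- c ∣ ℚ.< δ →
            ∣ a ℚ.* b ℚ.- c ℚ.* d ∣ ℚ.< (B ℚ.+ C) ℚ.* δ
  *-close a b c d {B} {C} {δ} a≤B 0<B d≤C 0<C b~d a~c = begin-strict
    ∣ a ℚ.* b ℚ.- c ℚ.* d ∣
      ≡⟨ cong ∣_∣ (*-diff a b c d) ⟩
    ∣ a ℚ.* (b ℚ.- d) ℚ.+ d ℚ.* (a ℚ.- c) ∣
      ≤⟨ ℚₚ.∣p+q∣≤∣p∣+∣q∣ (a ℚ.* (b ℚ.- d)) (d ℚ.* (a ℚ.- c)) ⟩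
    ∣ a ℚ.* (b ℚ.- d) ∣ ℚ.+ ∣ d ℚ.* (a ℚ.- c) ∣
      ≡⟨ cong₂ ℚ._+_ (ℚₚ.∣p*q∣≡∣p∣*∣q∣ a (b ℚ.- d)) (ℚₚ.∣p*q∣≡∣p∣*∣q∣ d (a ℚ.- c)) ⟩
    ∣ a ∣ ℚ.* ∣ b ℚ.- d ∣ ℚ.+ ∣ d ∣ ℚ.* ∣ a ℚ.- c ∣
      <⟨ ℚₚ.+-mono-< (*-≤-< (ℚₚ.0≤∣p∣ (b ℚ.- d)) a≤B 0<B b~d)
                     (*-≤-< (ℚₚ.0≤∣p∣ (a ℚ.- c)) d≤C 0<C a~c) ⟩
    B ℚ.* δ ℚ.+ C ℚ.* δ
      ≡⟨ ℚₚ.*-distribʳ-+ δ B C ⟨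
    (B ℚ.+ C) ℚ.* δ ∎
    where open ℚₚ.≤-Reasoning

  abstract
    *-cauchy : ∀ f g → IsCauchy f → IsCauchy g → IsCauchy (λ n → f n ℚ.* g n)
    *-cauchy f g cf cg ε 0<ε =
      let B , 0<B , K , f≤B = cauchy⇒bounded cf
          C , 0<C , L , g≤C = cauchy⇒bounded cg
          δ , 0<δ , eq      = split {ε} {B ℚ.+ C} 0<ε (ℚₚ.+-mono-< 0<B 0<C)
          M , hf            = cf δ 0<δ
          N , hg            = cg δ 0<δ
      in combine B C δ K L M N 0<B 0<C f≤B g≤C eq hf hg
      where
      combine : ∀ B C δ K L M N → 0ℚ ℚ.< B → 0ℚ ℚ.< C →
        (∀ n → K ≤ⁿ n → ∣ f n ∣ ℚ.≤ B) → (∀ n → L ≤ⁿ n → ∣ g n ∣ ℚ.≤ C) →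
        (B ℚ.+ C) ℚ.* δ ≡ ε →
        (∀ m n → M ≤ⁿ m → M ≤ⁿ n → ∣ f m ℚ.- f n ∣ ℚ.< δ) →
        (∀ m n → N ≤ⁿ m → N ≤ⁿ n → ∣ g m ℚ.- g n ∣ ℚ.< δ) →
        ∃ λ R → ∀ m n → R ≤ⁿ m → R ≤ⁿ n → ∣ f m ℚ.* g m ℚ.- f n ℚ.* g n ∣ ℚ.< ε
      combine B C δ K L M N 0<B 0<C f≤B g≤C eq hf hg =
        (K ⊔ L) ⊔ (M ⊔ N) , λ m n p q → subst (∣ f m ℚ.* g m ℚ.- f n ℚ.* g n ∣ ℚ.<_) eq
          (*-close (f m) (g m) (f n) (g n)
            (f≤B m (ℕₚ.m⊔n≤o⇒m≤o K L (toKL p))) 0<B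
            (g≤C n (ℕₚ.m⊔n≤o⇒n≤o K L (toKL q))) 0<C
            (hg m n (ℕₚ.m⊔n≤o⇒n≤o M N (toMN p)) (ℕₚ.m⊔n≤o⇒n≤o M N (toMN q)))
            (hf m n (ℕₚ.m⊔n≤o⇒m≤o M N (toMN p)) (ℕₚ.m⊔n≤o⇒m≤o M N (toMN q))))
        where
        toKL : ∀ {m} → (K ⊔ L) ⊔ (M ⊔ N) ≤ⁿ m → K ⊔ L ≤ⁿ m
        toKL = ℕₚ.m⊔n≤o⇒m≤o (K ⊔ L) (M ⊔ N)
        toMN : ∀ {m} → (K ⊔ L) ⊔ (M ⊔ N) ≤ⁿ m → M ⊔ N ≤ⁿ m
        toMN = ℕₚ.m⊔n≤o⇒n≤o (K ⊔ L) (M ⊔ N)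

_+_ : ℝ → ℝ → ℝ
x + y = mkℝ (λ n → seq x n ℚ.+ seq y n) (+-cauchy (seq x) (seq y) (cauchy x) (cauchy y))

_*_ : ℝ → ℝ → ℝ
x * y = mkℝ (λ n → seq x n ℚ.* seq y n) (*-cauchy (seq x) (seq y) (cauchy x) (cauchy y))

-_ : ℝ → ℝ
- x = mkℝ (λ n → ℚ.- seq x n) (neg-cauchy (seq x) (cauchy x))

_-_ : ℝ → ℝ → ℝ
x - y = x + (- y)

record ℂ : Set where
  constructor _+i_
  field
    re im : ℝ

open ℂ public

_≈ᶜ_ : ℂ → ℂ → Set
z ≈ᶜ w = re z ≈ re w × im z ≈ im w

0ℂ : ℂ
0ℂ = 0ℝ +i 0ℝ

_+ᶜ_ : ℂ → ℂ → ℂ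
z +ᶜ w = (re z + re w) +i (im z + im w)

_*ᶜ_ : ℂ → ℂ → ℂ
z *ᶜ w = (re z * re w - im z * im w) +i (re z * im w + im z * re w)

-- r = |z|, i.e. r is the nonnegative square root of (re z)² + (im z)².
IsModulus : ℂ → ℝ → Set
IsModulus z r = 0ℝ ≤ r × r * r ≈ re z * re z + im z * im z

𝕋 : Set
𝕋 = Σ ℂ λ z → IsModulus z 1ℝ

Matrix : ℕ → Set
Matrix n = Fin n → Fin n → ℂ

_*ᵛ_ : ∀ {n} → Matrix n → Vector ℂ n → Vector ℂ n
(A *ᵛ v) i = foldr _+ᶜ_ 0ℂ λ j → A i j *ᶜ v j

IsEigenvalue : ∀ {n} → Matrix n → ℂ → Set
IsEigenvalue {n} A μ = ∃ λ (v : Vector ℂ n) →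
  ¬ (∀ i → v i ≈ᶜ 0ℂ) × (∀ i → (A *ᵛ v) i ≈ᶜ μ *ᶜ v i)

-- ρ is the maximum of the moduli of the eigenvalues of A.  It is a relation,
-- since an eigenvalue attaining the maximum cannot be chosen constructively.
IsSpectralRadius : ∀ {n} → Matrix n → ℝ → Set
IsSpectralRadius A ρ =
  (∃ λ μ → IsEigenvalue A μ × IsModulus μ ρ) ×
  (∀ μ r → IsEigenvalue A μ → IsModulus μ r → r ≤ ρ)

-- The vertex set is Fin n, and (i , j) is an arc iff j ∈ out i.
record Digraph (n : ℕ) : Set where
  field
    out    : Fin n → Subset n
    noLoop : ∀ i → i ∉ out i

  deg⁺ : Fin n → ℕ
  deg⁺ i = Subset.∣ out i ∣

  Δ⁺ : ℕ
  Δ⁺ = foldr _⊔_ 0 deg⁺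

record GainDigraph (n : ℕ) : Set where
  field
    digraph : Digraph n

  open Digraph digraph public

  field
    φ : ∀ i j → j ∈ out i → 𝕋

adjacency : ∀ {n} → GainDigraph n → Matrix n
adjacency Φ i j with j ∈? GainDigraph.out Φ i
... | yes ij = proj₁ (GainDigraph.φ Φ i j ij)
... | no  _  = 0ℂ

{-# OPTIONS --safe #-}

-- Let v be an eigenvector for μ with |μ| = ρ. Each entry of row i of A(Φ) is 0
-- or has modulus 1, so Cauchy-Schwarz over the out-neighbours of i gives
--   ρ²|vᵢ|² = |Σⱼ aᵢⱼ vⱼ|² ≤ deg⁺(i) Σ_{j ∈ out i} |vⱼ|² ≤ Δ² M,  M = maxⱼ |vⱼ|².
-- An i attaining M cannot be chosen for real vⱼ, but it can be at each index n of
-- the Cauchy sequences: there ρₙ² Mₙ ≤ Δ² Mₙ + ε eventually, for every ε > 0. If ρ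
-- exceeded Δ by some η > 0 then η² Mₙ ≤ ε eventually, so Mₙ → 0 and v would be zero.

module Submission where

open import Defs
open import Data.Nat using (ℕ; zero; suc; _⊔_; z≤n; s≤s) renaming (_≤_ to _≤ⁿ_)
import Data.Nat.Properties as ℕₚ
open import Data.Nat.Coprimality using (1-coprimeTo) renaming (sym to coprime-sym)
open import Data.Integer as ℤ using (+_)
import Data.Integer.Properties as ℤₚ
open import Data.Rational as ℚ
  using (ℚ; 0ℚ; 1ℚ; ½; ∣_∣; _/_; 1/_; Positive; NonZero; positive; nonNegative)
import Data.Rational.Properties as ℚₚ
open import Data.Rational.Solver using (module +-*-Solver)
open import Data.Bool using (true; false)
open import Data.Fin using (Fin; zero; suc)
import Data.Fin.Subset as Subset
open import Data.Fin.Subset using (Subset; _∉_)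
open import Data.Fin.Subset.Properties using (_∈?_; drop-there)
open import Data.Vec using ([]; _∷_)
open import Data.Vec.Functional using (Vector; foldr)
open import Data.Product using (∃; _×_; _,_; proj₁; proj₂)
open import Data.Sum using (inj₁; inj₂)
open import Function using (_∘_)
open import Relation.Nullary using (yes; no; contradiction)
open import Relation.Binary.PropositionalEquality
  using (_≡_; refl; sym; trans; cong; cong₂; subst; subst₂)
open import Algebra.Bundles using (CommutativeRing)
open import Algebra.Properties.Semiring.Sum (CommutativeRing.semiring ℚₚ.+-*-commutativeRing)
  using (sum; ∑-distrib-+)

open +-*-Solver using (solve; _:+_; _:*_; _:-_; :-_; _:=_; con)

-- Ordered field of rationals

0≤p*q : ∀ {p q} → 0ℚ ℚ.≤ p → 0ℚ ℚ.≤ q → 0ℚ ℚ.≤ p ℚ.* q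
0≤p*q {p} {q} 0≤p 0≤q = ℚₚ.nonNegative⁻¹ (p ℚ.* q)
  {{ℚₚ.nonNeg*nonNeg⇒nonNeg p {{nonNegative 0≤p}} q {{nonNegative 0≤q}}}}

0<p*q : ∀ {p q} → 0ℚ ℚ.< p → 0ℚ ℚ.< q → 0ℚ ℚ.< p ℚ.* q
0<p*q {p} {q} 0<p 0<q =
  subst (ℚ._< p ℚ.* q) (ℚₚ.*-zeroˡ q) (ℚₚ.*-monoˡ-<-pos q {{positive 0<q}} 0<p)

*-mono-≤ : ∀ {a b c d} → 0ℚ ℚ.≤ b → 0ℚ ℚ.≤ c → a ℚ.≤ b → c ℚ.≤ d → a ℚ.* c ℚ.≤ b ℚ.* d
*-mono-≤ {a} {b} {c} {d} 0≤b 0≤c a≤b c≤d = ℚₚ.≤-trans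
  (ℚₚ.*-monoʳ-≤-nonNeg c {{nonNegative 0≤c}} a≤b)
  (ℚₚ.*-monoˡ-≤-nonNeg b {{nonNegative 0≤b}} c≤d)

∣p∣*∣p∣≡p*p : ∀ p → ∣ p ∣ ℚ.* ∣ p ∣ ≡ p ℚ.* p
∣p∣*∣p∣≡p*p p with ℚₚ.∣p∣≡p∨∣p∣≡-p p
... | inj₁ eq = cong₂ ℚ._*_ eq eq
... | inj₂ eq = trans (cong₂ ℚ._*_ eq eq)
  (solve 1 (λ p → (:- p) :* (:- p) := p :* p) refl p)

0≤p*p : ∀ p → 0ℚ ℚ.≤ p ℚ.* p
0≤p*p p = subst (0ℚ ℚ.≤_) (∣p∣*∣p∣≡p*p p) (0≤p*q (ℚₚ.0≤∣p∣ p) (ℚₚ.0≤∣p∣ p))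

0≤q-p⇒p≤q : ∀ {p q} → 0ℚ ℚ.≤ q ℚ.- p → p ℚ.≤ q
0≤q-p⇒p≤q {p} {q} 0≤q-p = subst₂ ℚ._≤_ (ℚₚ.+-identityˡ p)
  (solve 2 (λ p q → (q :- p) :+ p := q) refl p q) (ℚₚ.+-monoˡ-≤ p 0≤q-p)

p≤q⇒0≤q-p : ∀ {p q} → p ℚ.≤ q → 0ℚ ℚ.≤ q ℚ.- p
p≤q⇒0≤q-p {p} {q} p≤q =
  subst (ℚ._≤ q ℚ.- p) (ℚₚ.+-inverseʳ p) (ℚₚ.+-monoˡ-≤ (ℚ.- p) p≤q)

2pq≤p²+q² : ∀ p q → p ℚ.* q ℚ.+ p ℚ.* q ℚ.≤ p ℚ.* p ℚ.+ q ℚ.* q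
2pq≤p²+q² p q = 0≤q-p⇒p≤q (subst (0ℚ ℚ.≤_)
  (solve 2 (λ p q → (p :- q) :* (p :- q) := (p :* p :+ q :* q) :- (p :* q :+ p :* q)) refl p q)
  (0≤p*p (p ℚ.- q)))

∣p-q∣≡∣q-p∣ : ∀ p q → ∣ p ℚ.- q ∣ ≡ ∣ q ℚ.- p ∣
∣p-q∣≡∣q-p∣ p q = trans (sym (ℚₚ.∣-p∣≡∣p∣ (p ℚ.- q)))
  (cong ∣_∣ (solve 2 (λ p q → :- (p :- q) := q :- p) refl p q))

p≤∣p∣ : ∀ p → p ℚ.≤ ∣ p ∣
p≤∣p∣ p with ℚₚ.≤-total 0ℚ p
... | inj₁ 0≤p = ℚₚ.≤-reflexive (sym (ℚₚ.0≤p⇒∣p∣≡p 0≤p))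
... | inj₂ p≤0 = ℚₚ.≤-trans p≤0 (ℚₚ.0≤∣p∣ p)

∣p-q∣<ε⇒p≤q+ε : ∀ {p q ε} → ∣ p ℚ.- q ∣ ℚ.< ε → p ℚ.≤ q ℚ.+ ε
∣p-q∣<ε⇒p≤q+ε {p} {q} {ε} p~q = subst (ℚ._≤ q ℚ.+ ε)
  (solve 2 (λ p q → q :+ (p :- q) := p) refl p q)
  (ℚₚ.+-monoʳ-≤ q (ℚₚ.≤-trans (p≤∣p∣ (p ℚ.- q)) (ℚₚ.<⇒≤ p~q)))

ε/2+ε/2 : ∀ ε → ε ℚ.* ½ ℚ.+ ε ℚ.* ½ ≡ ε
ε/2+ε/2 = solve 1 (λ e → e :* con ½ :+ e :* con ½ := e) refl

0<ε/2 : ∀ {ε} → 0ℚ ℚ.< ε → 0ℚ ℚ.< ε ℚ.* ½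
0<ε/2 0<ε = 0<p*q 0<ε (ℚₚ.positive⁻¹ ½)

fraction : ∀ {ε B} → 0ℚ ℚ.< ε → 0ℚ ℚ.< B → ∃ λ δ → 0ℚ ℚ.< δ × δ ℚ.* B ≡ ε
fraction {ε} {B} 0<ε 0<B = ε ℚ.* 1/ B , 0<p*q 0<ε (ℚₚ.positive⁻¹ (1/ B)) ,
  trans (ℚₚ.*-assoc ε (1/ B) B)
    (trans (cong (ε ℚ.*_) (ℚₚ.*-inverseˡ B)) (ℚₚ.*-identityʳ ε))
  where
  instance
    B-pos : Positive B
    B-pos = positive 0<B
    B-nonZero : NonZero B
    B-nonZero = ℚₚ.pos⇒nonZero B
    1/B-pos : Positive (1/ B)
    1/B-pos = ℚₚ.1/pos⇒pos B

∣p*q∣<δ*B : ∀ p q {δ B} → 0ℚ ℚ.< B → ∣ p ∣ ℚ.< δ → ∣ q ∣ ℚ.≤ B → ∣ p ℚ.* q ∣ ℚ.< δ ℚ.* B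
∣p*q∣<δ*B p q {δ} {B} 0<B p<δ q≤B = subst (ℚ._< δ ℚ.* B) (sym (ℚₚ.∣p*q∣≡∣p∣*∣q∣ p q))
  (ℚₚ.≤-<-trans (ℚₚ.*-monoˡ-≤-nonNeg ∣ p ∣ {{ℚₚ.∣-∣-nonNeg p}} q≤B)
    (ℚₚ.*-monoˡ-<-pos B {{positive 0<B}} p<δ))

ι : ℕ → ℚ
ι n = + n / 1

-- `+ n / 1` normalises through a gcd that does not compute for a variable `n`. Coprimality of n and
-- 1 shows it is already in lowest terms, and then the addition reduces.
ι-suc : ∀ n → ι (suc n) ≡ 1ℚ ℚ.+ ι n
ι-suc n = sym (trans (cong (1ℚ ℚ.+_) (ℚₚ.normalize-coprime (coprime-sym (1-coprimeTo n))))
  (cong (λ k → (+ 1 ℤ.+ k) / 1) (ℤₚ.*-identityʳ (+ n))))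

0≤ι : ∀ n → 0ℚ ℚ.≤ ι n
0≤ι zero    = ℚₚ.≤-refl
0≤ι (suc n) = subst (0ℚ ℚ.≤_) (sym (ι-suc n))
  (ℚₚ.+-mono-≤ (ℚₚ.<⇒≤ (ℚₚ.positive⁻¹ 1ℚ)) (0≤ι n))

ι-mono : ∀ {m n} → m ≤ⁿ n → ι m ℚ.≤ ι n
ι-mono {n = n} z≤n = 0≤ι n
ι-mono {suc m} {suc n} (s≤s m≤n) =
  subst₂ ℚ._≤_ (sym (ι-suc m)) (sym (ι-suc n)) (ℚₚ.+-monoʳ-≤ 1ℚ (ι-mono m≤n))

-- Sums and maxima of finite families of rationals

SupportedOn : ∀ {n} → Subset n → Vector ℚ n → Set
SupportedOn S x = ∀ j → j ∉ S → x j ≡ 0ℚ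

supported-tail : ∀ {n b} {S : Subset n} {x} → SupportedOn (b ∷ S) x → SupportedOn S (x ∘ suc)
supported-tail x⊆S j j∉S = x⊆S (suc j) (j∉S ∘ drop-there)

-- Adds up 2t xⱼ ≤ t² + xⱼ² over j in `S`. With t the head entry, this bounds the cross term in the
-- inductive step of `cauchy-schwarz`.
2t∑x≤|S|t²+∑x² : ∀ {n} (S : Subset n) {x} → SupportedOn S x → ∀ t →
  t ℚ.* sum x ℚ.+ t ℚ.* sum x ℚ.≤
    ι Subset.∣ S ∣ ℚ.* (t ℚ.* t) ℚ.+ sum (λ j → x j ℚ.* x j)
2t∑x≤|S|t²+∑x² [] _ t = ℚₚ.≤-reflexive
  (solve 1 (λ t → t :* con 0ℚ :+ t :* con 0ℚ := con 0ℚ :* (t :* t) :+ con 0ℚ) refl t)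
2t∑x≤|S|t²+∑x² (true ∷ S) {x} x⊆S t = subst₂ ℚ._≤_
  (solve 3 (λ t y s → (t :* y :+ t :* y) :+ (t :* s :+ t :* s)
                   := t :* (y :+ s) :+ t :* (y :+ s)) refl t (x zero) (sum (x ∘ suc)))
  (trans (solve 4 (λ t y d q → (t :* t :+ y :* y) :+ (d :* (t :* t) :+ q)
                   := (con 1ℚ :+ d) :* (t :* t) :+ (y :* y :+ q)) refl t (x zero) (ι Subset.∣ S ∣)
                   (sum (λ j → x (suc j) ℚ.* x (suc j))))
    (cong (λ d → d ℚ.* (t ℚ.* t) ℚ.+ sum (λ j → x j ℚ.* x j)) (sym (ι-suc Subset.∣ S ∣))))
  (ℚₚ.+-mono-≤ (2pq≤p²+q² t (x zero)) (2t∑x≤|S|t²+∑x² S (supported-tail x⊆S) t))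
-- The head lies outside `S`, so it is 0. After rewriting, only a leading zero in each sum has to be
-- cancelled.
2t∑x≤|S|t²+∑x² (false ∷ S) {x} x⊆S t rewrite x⊆S zero (λ ())
  | ℚₚ.+-identityˡ (sum (x ∘ suc))
  | ℚₚ.+-identityˡ (sum (λ j → x (suc j) ℚ.* x (suc j))) =
  2t∑x≤|S|t²+∑x² S (supported-tail x⊆S) t

-- Induction on `S`, with head y, tail sum s, tail sum of squares q and d elements in the tail of
-- `S`. In (y + s)² = y² + 2ys + s² the cross term is at most dy² + q and s² is at most dq; together
-- this gives (1 + d)(y² + q).
cauchy-schwarz : ∀ {n} (S : Subset n) {x} → SupportedOn S x →
  sum x ℚ.* sum x ℚ.≤ ι Subset.∣ S ∣ ℚ.* sum (λ j → x j ℚ.* x j)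
cauchy-schwarz [] _ = ℚₚ.≤-refl
cauchy-schwarz (true ∷ S) {x} x⊆S = subst₂ ℚ._≤_
  (solve 2 (λ y s → (y :* y :+ (y :* s :+ y :* s)) :+ s :* s := (y :+ s) :* (y :+ s)) refl
    (x zero) (sum (x ∘ suc)))
  (trans (solve 3 (λ y d q → (y :* y :+ (d :* (y :* y) :+ q)) :+ d :* q
                   := (con 1ℚ :+ d) :* (y :* y :+ q)) refl (x zero) (ι Subset.∣ S ∣)
                   (sum (λ j → x (suc j) ℚ.* x (suc j))))
    (cong (ℚ._* sum (λ j → x j ℚ.* x j)) (sym (ι-suc Subset.∣ S ∣))))
  (ℚₚ.+-mono-≤
    (ℚₚ.+-monoʳ-≤ (x zero ℚ.* x zero) (2t∑x≤|S|t²+∑x² S (supported-tail x⊆S) (x zero)))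
    (cauchy-schwarz S (supported-tail x⊆S)))
cauchy-schwarz (false ∷ S) {x} x⊆S rewrite x⊆S zero (λ ())
  | ℚₚ.+-identityˡ (sum (x ∘ suc))
  | ℚₚ.+-identityˡ (sum (λ j → x (suc j) ℚ.* x (suc j))) =
  cauchy-schwarz S (supported-tail x⊆S)

sum≤|S|*max : ∀ {n} (S : Subset n) {x M} → SupportedOn S x → (∀ j → x j ℚ.≤ M) →
  sum x ℚ.≤ ι Subset.∣ S ∣ ℚ.* M
sum≤|S|*max [] {M = M} _ _ = ℚₚ.≤-reflexive (sym (ℚₚ.*-zeroˡ M))
sum≤|S|*max (true ∷ S) {x} {M} x⊆S x≤M = subst (sum x ℚ.≤_)
  (trans (solve 2 (λ d m → m :+ d :* m := (con 1ℚ :+ d) :* m) refl (ι Subset.∣ S ∣) M)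
    (cong (ℚ._* M) (sym (ι-suc Subset.∣ S ∣))))
  (ℚₚ.+-mono-≤ (x≤M zero) (sum≤|S|*max S (supported-tail x⊆S) (x≤M ∘ suc)))
sum≤|S|*max (false ∷ S) {x} x⊆S x≤M rewrite x⊆S zero (λ ())
  | ℚₚ.+-identityˡ (sum (x ∘ suc)) =
  sum≤|S|*max S (supported-tail x⊆S) (x≤M ∘ suc)

-- The default 0 is harmless for the families of squared moduli to which this is applied.
max : ∀ {n} → Vector ℚ n → ℚ
max = foldr ℚ._⊔_ 0ℚ

x≤max : ∀ {n} (x : Vector ℚ n) i → x i ℚ.≤ max x
x≤max x zero    = ℚₚ.p≤p⊔q (x zero) (max (x ∘ suc))
x≤max x (suc i) = ℚₚ.≤-trans (x≤max (x ∘ suc) i) (ℚₚ.p≤q⊔p (x zero) (max (x ∘ suc)))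

0≤max : ∀ {n} (x : Vector ℚ n) → 0ℚ ℚ.≤ max x
0≤max {zero}  x = ℚₚ.≤-refl
0≤max {suc n} x = ℚₚ.≤-trans (0≤max (x ∘ suc)) (ℚₚ.p≤q⊔p (x zero) (max (x ∘ suc)))

-- The order on ℚ is total and decidable, so the maximum is one of the entries or the default 0; the
-- latter accounts for `0ℚ ≤ B`.
c*max≤ : ∀ {n} (x : Vector ℚ n) {c B} → 0ℚ ℚ.≤ B → (∀ i → c ℚ.* x i ℚ.≤ B) → c ℚ.* max x ℚ.≤ B
c*max≤ {zero}  x {c} {B} 0≤B _ = subst (ℚ._≤ B) (sym (ℚₚ.*-zeroʳ c)) 0≤B
c*max≤ {suc n} x {c} {B} 0≤B cx≤B with ℚₚ.≤-total (x zero) (max (x ∘ suc))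
... | inj₁ le = subst (λ m → c ℚ.* m ℚ.≤ B) (sym (ℚₚ.p≤q⇒p⊔q≡q le)) (c*max≤ (x ∘ suc) {c} 0≤B (cx≤B ∘ suc))
... | inj₂ ge = subst (λ m → c ℚ.* m ℚ.≤ B) (sym (ℚₚ.p≥q⇒p⊔q≡p ge)) (cx≤B zero)

x≤⊔ : ∀ {n} (x : Vector ℕ n) i → x i ≤ⁿ foldr _⊔_ 0 x
x≤⊔ x zero    = ℕₚ.m≤m⊔n (x zero) _
x≤⊔ x (suc i) = ℕₚ.≤-trans (x≤⊔ (x ∘ suc) i) (ℕₚ.m≤n⊔m (x zero) _)

-- Real numbers

Eventually : (ℕ → Set) → Set
Eventually P = ∃ λ N → ∀ n → N ≤ⁿ n → P n

always : ∀ {P : ℕ → Set} → (∀ n → P n) → Eventually P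
always p = 0 , λ n _ → p n

ev-map : ∀ {P Q : ℕ → Set} → (∀ n → P n → Q n) → Eventually P → Eventually Q
ev-map f (N , p) = N , λ n N≤n → f n (p n N≤n)

ev-zip : ∀ {P Q R : ℕ → Set} → (∀ n → P n → Q n → R n) →
  Eventually P → Eventually Q → Eventually R
ev-zip f (M , p) (N , q) = M ⊔ N , λ n le →
  f n (p n (ℕₚ.m⊔n≤o⇒m≤o M N le)) (q n (ℕₚ.m⊔n≤o⇒n≤o M N le))

-- Finitely many thresholds have a common upper bound. This lets all rows of the matrix be compared
-- at the same index.
ev-∀ : ∀ {m} {P : Fin m → ℕ → Set} → (∀ i → Eventually (P i)) → Eventually (λ n → ∀ i → P i n)
ev-∀ {zero}  _ = always λ _ ()
ev-∀ {suc m} p = ev-zip (λ n → λ { p₀ ps zero → p₀ ; p₀ ps (suc i) → ps i }) (p zero) (ev-∀ (p ∘ suc))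

-- `x ≈ y` unfolds to `Null` of the termwise difference, so transitivity and the congruence laws
-- reduce to closure properties of null sequences.
Null : (ℕ → ℚ) → Set
Null s = ∀ ε → 0ℚ ℚ.< ε → Eventually λ n → ∣ s n ∣ ℚ.< ε

null-resp : ∀ {s t} → (∀ n → s n ≡ t n) → Null s → Null t
null-resp s≗t s→0 ε 0<ε = ev-map (λ n → subst (λ q → ∣ q ∣ ℚ.< ε) (s≗t n)) (s→0 ε 0<ε)

null-+ : ∀ {s t} → Null s → Null t → Null (λ n → s n ℚ.+ t n)
null-+ {s} {t} s→0 t→0 ε 0<ε = ev-zip
  (λ n s<ε t<ε → subst (∣ s n ℚ.+ t n ∣ ℚ.<_) (ε/2+ε/2 ε)
    (ℚₚ.≤-<-trans (ℚₚ.∣p+q∣≤∣p∣+∣q∣ (s n) (t n)) (ℚₚ.+-mono-< s<ε t<ε)))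
  (s→0 _ (0<ε/2 0<ε)) (t→0 _ (0<ε/2 0<ε))

bounded : ∀ x → ∃ λ B → 0ℚ ℚ.< B × Eventually (λ n → ∣ seq x n ∣ ℚ.≤ B)
bounded x with cauchy x 1ℚ (ℚₚ.positive⁻¹ 1ℚ)
... | N , close = 1ℚ ℚ.+ ∣ seq x N ∣
    , ℚₚ.+-mono-<-≤ (ℚₚ.positive⁻¹ 1ℚ) (ℚₚ.0≤∣p∣ (seq x N))
    , N , λ n N≤n → ℚₚ.≤-trans
      (subst (λ q → ∣ q ∣ ℚ.≤ ∣ seq x n ℚ.- seq x N ∣ ℚ.+ ∣ seq x N ∣)
        (solve 2 (λ p q → (p :- q) :+ q := p) refl (seq x n) (seq x N))
        (ℚₚ.∣p+q∣≤∣p∣+∣q∣ (seq x n ℚ.- seq x N) (seq x N)))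
      (ℚₚ.+-monoˡ-≤ ∣ seq x N ∣ (ℚₚ.<⇒≤ (close n N N≤n ℕₚ.≤-refl)))

null-* : ∀ {s} → Null s → ∀ x → Null (λ n → s n ℚ.* seq x n)
null-* {s} s→0 x ε 0<ε =
  let B , 0<B , x≤B    = bounded x
      δ , 0<δ , δB≡ε   = fraction 0<ε 0<B
  in ev-zip (λ n s<δ x≤B → subst (∣ s n ℚ.* seq x n ∣ ℚ.<_) δB≡ε
               (∣p*q∣<δ*B (s n) (seq x n) 0<B s<δ x≤B))
       (s→0 δ 0<δ) x≤B

≗⇒≈ : ∀ {x y} → (∀ n → seq x n ≡ seq y n) → x ≈ y
≗⇒≈ {x} {y} x≗y ε 0<ε = always λ n → subst (λ q → ∣ q ∣ ℚ.< ε)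
  (sym (trans (cong (ℚ._- seq y n) (x≗y n)) (ℚₚ.+-inverseʳ (seq y n)))) 0<ε

≈-sym : ∀ {x y} → x ≈ y → y ≈ x
≈-sym {x} {y} x≈y ε 0<ε =
  ev-map (λ n → subst (ℚ._< ε) (∣p-q∣≡∣q-p∣ (seq x n) (seq y n))) (x≈y ε 0<ε)

≈-trans : ∀ {x y z} → x ≈ y → y ≈ z → x ≈ z
≈-trans {x} {y} {z} x≈y y≈z = null-resp
  (λ n → solve 3 (λ x y z → (x :- y) :+ (y :- z) := x :- z) refl (seq x n) (seq y n) (seq z n))
  (null-+ x≈y y≈z)

+-cong : ∀ {x x′ y y′} → x ≈ x′ → y ≈ y′ → x + y ≈ x′ + y′
+-cong {x} {x′} {y} {y′} x≈x′ y≈y′ = null-resp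
  (λ n → solve 4 (λ x x′ y y′ → (x :- x′) :+ (y :- y′) := (x :+ y) :- (x′ :+ y′)) refl
    (seq x n) (seq x′ n) (seq y n) (seq y′ n))
  (null-+ x≈x′ y≈y′)

*-cong : ∀ {x x′ y y′} → x ≈ x′ → y ≈ y′ → x * y ≈ x′ * y′
*-cong {x} {x′} {y} {y′} x≈x′ y≈y′ = null-resp
  (λ n → solve 4 (λ x x′ y y′ → (x :- x′) :* y :+ (y :- y′) :* x′ := x :* y :- x′ :* y′) refl
    (seq x n) (seq x′ n) (seq y n) (seq y′ n))
  (null-+ (null-* x≈x′ y) (null-* y≈y′ x′))

≈⇒≤ : ∀ {x y} → x ≈ y → x ≤ y
≈⇒≤ x≈y ε 0<ε = ev-map (λ _ → ∣p-q∣<ε⇒p≤q+ε) (x≈y ε 0<ε)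

pointwise⇒≤ : ∀ {x y} → (∀ n → seq x n ℚ.≤ seq y n) → x ≤ y
pointwise⇒≤ {x} {y} x≤y ε 0<ε = always λ n →
  ℚₚ.≤-trans (x≤y n) (subst (ℚ._≤ seq y n ℚ.+ ε) (ℚₚ.+-identityʳ (seq y n))
    (ℚₚ.+-monoʳ-≤ (seq y n) (ℚₚ.<⇒≤ 0<ε)))

≤-trans : ∀ {x y z} → x ≤ y → y ≤ z → x ≤ z
≤-trans {x} {y} {z} x≤y y≤z ε 0<ε = ev-zip
  (λ n p q → ℚₚ.≤-trans p (subst (seq y n ℚ.+ ε ℚ.* ½ ℚ.≤_)
    (trans (ℚₚ.+-assoc (seq z n) _ _) (cong (seq z n ℚ.+_) (ε/2+ε/2 ε)))
    (ℚₚ.+-monoˡ-≤ (ε ℚ.* ½) q)))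
  (x≤y _ (0<ε/2 0<ε)) (y≤z _ (0<ε/2 0<ε))

∑ : ∀ {n} → Vector ℝ n → ℝ
∑ = foldr _+_ 0ℝ

∑-cong : ∀ {n} {x y : Vector ℝ n} → (∀ i → x i ≈ y i) → ∑ x ≈ ∑ y
∑-cong {zero}  _   = ≗⇒≈ {0ℝ} {0ℝ} λ _ → refl
∑-cong {suc n} {x} {y} x≈y =
  +-cong {x zero} {y zero} {∑ (x ∘ suc)} {∑ (y ∘ suc)} (x≈y zero) (∑-cong (x≈y ∘ suc))

seq-∑ : ∀ {n} (x : Vector ℝ n) k → seq (∑ x) k ≡ sum (λ i → seq (x i) k)
seq-∑ {zero}  x k = refl
seq-∑ {suc n} x k = cong (seq (x zero) k ℚ.+_) (seq-∑ (x ∘ suc) k)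

-- Complex numbers

-- Working with squared moduli keeps everything polynomial in the real and imaginary parts and
-- avoids square roots.
∥_∥² : ℂ → ℝ
∥ z ∥² = re z * re z + im z * im z

∥∥²-cong : ∀ {z w} → z ≈ᶜ w → ∥ z ∥² ≈ ∥ w ∥²
∥∥²-cong {z} {w} (re≈ , im≈) =
  +-cong {re z * re z} {re w * re w} {im z * im z} {im w * im w}
    (*-cong {re z} {re w} {re z} {re w} re≈ re≈)
    (*-cong {im z} {im w} {im z} {im w} im≈ im≈)

-- Brahmagupta's two-square identity, valid exactly at every index of the sequences.
∥∥²-homo-* : ∀ z w → ∥ z *ᶜ w ∥² ≈ ∥ z ∥² * ∥ w ∥²
∥∥²-homo-* z w = ≗⇒≈ {∥ z *ᶜ w ∥²} {∥ z ∥² * ∥ w ∥²} λ n →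
  solve 4 (λ a b c d → (a :* c :- b :* d) :* (a :* c :- b :* d) :+ (a :* d :+ b :* c) :* (a :* d :+ b :* c)
                    := (a :* a :+ b :* b) :* (c :* c :+ d :* d)) refl
    (seq (re z) n) (seq (im z) n) (seq (re w) n) (seq (im w) n)

re²≤∥∥² : ∀ z n → seq (re z) n ℚ.* seq (re z) n ℚ.≤ seq ∥ z ∥² n
re²≤∥∥² z n = subst (ℚ._≤ seq ∥ z ∥² n) (ℚₚ.+-identityʳ _)
  (ℚₚ.+-monoʳ-≤ (seq (re z) n ℚ.* seq (re z) n) (0≤p*p (seq (im z) n)))

im²≤∥∥² : ∀ z n → seq (im z) n ℚ.* seq (im z) n ℚ.≤ seq ∥ z ∥² n
im²≤∥∥² z n = subst (ℚ._≤ seq ∥ z ∥² n) (ℚₚ.+-identityˡ _)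
  (ℚₚ.+-monoˡ-≤ (seq (im z) n ℚ.* seq (im z) n) (0≤p*p (seq (re z) n)))

∑ᶜ : ∀ {n} → Vector ℂ n → ℂ
∑ᶜ = foldr _+ᶜ_ 0ℂ

seq-re-∑ᶜ : ∀ {n} (z : Vector ℂ n) k → seq (re (∑ᶜ z)) k ≡ sum (λ i → seq (re (z i)) k)
seq-re-∑ᶜ {zero}  z k = refl
seq-re-∑ᶜ {suc n} z k = cong (seq (re (z zero)) k ℚ.+_) (seq-re-∑ᶜ (z ∘ suc) k)

seq-im-∑ᶜ : ∀ {n} (z : Vector ℂ n) k → seq (im (∑ᶜ z)) k ≡ sum (λ i → seq (im (z i)) k)
seq-im-∑ᶜ {zero}  z k = refl
seq-im-∑ᶜ {suc n} z k = cong (seq (im (z zero)) k ℚ.+_) (seq-im-∑ᶜ (z ∘ suc) k)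

-- At each index the rational inequality is applied to the real and the imaginary parts separately,
-- and the two results are added.
cauchy-schwarzᶜ : ∀ {n} (S : Subset n) (z : Vector ℂ n) →
  (∀ k → SupportedOn S (λ j → seq (re (z j)) k)) →
  (∀ k → SupportedOn S (λ j → seq (im (z j)) k)) →
  ∥ ∑ᶜ z ∥² ≤ fromℕ Subset.∣ S ∣ * ∑ (λ j → ∥ z j ∥²)
cauchy-schwarzᶜ S z re⊆S im⊆S =
  pointwise⇒≤ {∥ ∑ᶜ z ∥²} {fromℕ Subset.∣ S ∣ * ∑ (λ j → ∥ z j ∥²)} λ k →
    subst₂ ℚ._≤_
      (sym (cong₂ ℚ._+_ (cong₂ ℚ._*_ (seq-re-∑ᶜ z k) (seq-re-∑ᶜ z k))
                        (cong₂ ℚ._*_ (seq-im-∑ᶜ z k) (seq-im-∑ᶜ z k))))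
      (trans (sym (ℚₚ.*-distribˡ-+ (ι Subset.∣ S ∣) (sum (re² k)) (sum (im² k))))
        (cong (ι Subset.∣ S ∣ ℚ.*_)
          (trans (sym (∑-distrib-+ (re² k) (im² k))) (sym (seq-∑ (λ j → ∥ z j ∥²) k)))))
      (ℚₚ.+-mono-≤ (cauchy-schwarz S (re⊆S k)) (cauchy-schwarz S (im⊆S k)))
  where
  re² im² : ℕ → Vector ℚ _
  re² k j = seq (re (z j)) k ℚ.* seq (re (z j)) k
  im² k j = seq (im (z j)) k ℚ.* seq (im (z j)) k

-- Row estimates for the gain adjacency matrix

-- Turns a sum over `S` into a sum over all of `Fin n`. The test is the one in `adjacency`, so a
-- single case split resolves both.
restrict : ∀ {n} → Subset n → Vector ℝ n → Vector ℝ n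
restrict S x j with j ∈? S
... | yes _ = x j
... | no  _ = 0ℝ

restrict-supported : ∀ {n} (S : Subset n) x k → SupportedOn S (λ j → seq (restrict S x j) k)
restrict-supported S x k j j∉S with j ∈? S
... | yes j∈S = contradiction j∈S j∉S
... | no  _   = refl

restrict-≤ : ∀ {n} (S : Subset n) x k {M} → 0ℚ ℚ.≤ M → (∀ j → seq (x j) k ℚ.≤ M) →
  ∀ j → seq (restrict S x j) k ℚ.≤ M
restrict-≤ S x k 0≤M x≤M j with j ∈? S
... | yes _ = x≤M j
... | no  _ = 0≤M

-- From r ≥ D + η it follows that r² - D² ≥ η² + 2Dη. Accordingly ε - η²M splits into three
-- nonnegative terms: the slack D²M + ε - r²M, then (r² - (D + η)²)M, then 2DηM.
gap-cancel : ∀ {D η r M ε} → 0ℚ ℚ.≤ D → 0ℚ ℚ.< η → D ℚ.+ η ℚ.≤ r → 0ℚ ℚ.≤ M →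
  r ℚ.* r ℚ.* M ℚ.≤ D ℚ.* D ℚ.* M ℚ.+ ε → η ℚ.* η ℚ.* M ℚ.≤ ε
gap-cancel {D} {η} {r} {M} {ε} 0≤D 0<η D+η≤r 0≤M r²M≤D²M+ε = 0≤q-p⇒p≤q (subst (0ℚ ℚ.≤_)
  (solve 5 (λ D η r M e → ((D :* D :* M :+ e :- r :* r :* M)
                            :+ (r :* r :- (D :+ η) :* (D :+ η)) :* M)
                            :+ (D :* η :+ D :* η) :* M
                       := e :- η :* η :* M) refl D η r M ε)
  (ℚₚ.+-mono-≤ (ℚₚ.+-mono-≤ (p≤q⇒0≤q-p r²M≤D²M+ε)
      (0≤p*q (p≤q⇒0≤q-p (*-mono-≤ 0≤r 0≤D+η D+η≤r D+η≤r)) 0≤M))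
    (0≤p*q (ℚₚ.+-mono-≤ (0≤p*q 0≤D 0≤η) (0≤p*q 0≤D 0≤η)) 0≤M)))
  where
  0≤η : 0ℚ ℚ.≤ η
  0≤η = ℚₚ.<⇒≤ 0<η
  0≤D+η : 0ℚ ℚ.≤ D ℚ.+ η
  0≤D+η = ℚₚ.+-mono-≤ 0≤D 0≤η
  0≤r : 0ℚ ℚ.≤ r
  0≤r = ℚₚ.≤-trans 0≤D+η D+η≤r

module _ {n : ℕ} (Φ : GainDigraph n) where
  open GainDigraph Φ

  private
    A = adjacency Φ

  -- Stated with `_≡_` because the Cauchy-Schwarz step works index by index and needs zeros at every
  -- index, not just in the limit.
  A-outside : ∀ i j → j ∉ out i → A i j ≡ 0ℂ
  A-outside i j j∉ with j ∈? out i
  ... | yes j∈ = contradiction j∈ j∉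
  ... | no  _  = refl

  -- The squared modulus is multiplicative, and a gain on the unit circle contributes the factor 1.
  ∥Aᵢⱼvⱼ∥²≈restrict : ∀ (v : Vector ℂ n) i j → ∥ A i j *ᶜ v j ∥² ≈ restrict (out i) (λ j → ∥ v j ∥²) j
  ∥Aᵢⱼvⱼ∥²≈restrict v i j with j ∈? out i
  ... | yes ij =
    ≈-trans {∥ a *ᶜ v j ∥²} {∥ a ∥² * ∥ v j ∥²} {∥ v j ∥²} (∥∥²-homo-* a (v j))
      (≈-trans {∥ a ∥² * ∥ v j ∥²} {(1ℝ * 1ℝ) * ∥ v j ∥²} {∥ v j ∥²}
        (*-cong {∥ a ∥²} {1ℝ * 1ℝ} {∥ v j ∥²} {∥ v j ∥²}
          (≈-sym {1ℝ * 1ℝ} {∥ a ∥²} (proj₂ (proj₂ (φ i j ij))))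
          (≗⇒≈ {∥ v j ∥²} {∥ v j ∥²} λ _ → refl))
        (≗⇒≈ {(1ℝ * 1ℝ) * ∥ v j ∥²} {∥ v j ∥²} λ k → ℚₚ.*-identityˡ (seq ∥ v j ∥² k)))
    where a = proj₁ (φ i j ij)
  ... | no _ =
    ≈-trans {∥ 0ℂ *ᶜ v j ∥²} {∥ 0ℂ ∥² * ∥ v j ∥²} {0ℝ} (∥∥²-homo-* 0ℂ (v j))
      (≗⇒≈ {∥ 0ℂ ∥² * ∥ v j ∥²} {0ℝ} λ k → ℚₚ.*-zeroˡ (seq ∥ v j ∥² k))

  row-bound : ∀ (v : Vector ℂ n) i →
    ∥ (A *ᵛ v) i ∥² ≤ fromℕ (deg⁺ i) * ∑ (restrict (out i) (λ j → ∥ v j ∥²))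
  row-bound v i =
    ≤-trans {∥ (A *ᵛ v) i ∥²} {d * ∑ (λ j → ∥ A i j *ᶜ v j ∥²)} {d * ∑ r}
      (cauchy-schwarzᶜ (out i) (λ j → A i j *ᶜ v j) re⊆ im⊆)
      (≈⇒≤ {d * ∑ (λ j → ∥ A i j *ᶜ v j ∥²)} {d * ∑ r}
        (*-cong {d} {d} {∑ (λ j → ∥ A i j *ᶜ v j ∥²)} {∑ r}
          (≗⇒≈ {d} {d} λ _ → refl) (∑-cong (∥Aᵢⱼvⱼ∥²≈restrict v i))))
    where
    d = fromℕ (deg⁺ i)
    r = restrict (out i) (λ j → ∥ v j ∥²)
    re⊆ : ∀ k → SupportedOn (out i) (λ j → seq (re (A i j *ᶜ v j)) k)
    re⊆ k j j∉ rewrite A-outside i j j∉ =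
      solve 2 (λ a b → con 0ℚ :* a :- con 0ℚ :* b := con 0ℚ) refl
        (seq (re (v j)) k) (seq (im (v j)) k)
    im⊆ : ∀ k → SupportedOn (out i) (λ j → seq (im (A i j *ᶜ v j)) k)
    im⊆ k j j∉ rewrite A-outside i j j∉ =
      solve 2 (λ a b → con 0ℚ :* b :+ con 0ℚ :* a := con 0ℚ) refl
        (seq (re (v j)) k) (seq (im (v j)) k)

  -- Formed at each index separately, where the entries are rationals and an entry attaining the
  -- maximum can be found. That entry may change with the index.
  maxSq : Vector ℂ n → ℕ → ℚ
  maxSq v k = max (λ i → seq ∥ v i ∥² k)

  -- The out-degree enters twice: once as the Cauchy-Schwarz factor, once as the number of summands,
  -- each at most the maximum. Hence the square of `Δ⁺`.
  row-max-bound : ∀ (v : Vector ℂ n) i k →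
    seq (fromℕ (deg⁺ i) * ∑ (restrict (out i) (λ j → ∥ v j ∥²))) k
      ℚ.≤ ι Δ⁺ ℚ.* ι Δ⁺ ℚ.* maxSq v k
  row-max-bound v i k = ℚₚ.≤-trans
    (ℚₚ.*-monoˡ-≤-nonNeg d {{nonNegative (0≤ι (deg⁺ i))}}
      (subst (ℚ._≤ d ℚ.* M) (sym (seq-∑ (restrict (out i) q) k))
        (sum≤|S|*max (out i) (restrict-supported (out i) q k)
          (restrict-≤ (out i) q k 0≤M (x≤max (λ j → seq (q j) k))))))
    (subst (ℚ._≤ ι Δ⁺ ℚ.* ι Δ⁺ ℚ.* M) (ℚₚ.*-assoc d d M)
      (ℚₚ.*-monoʳ-≤-nonNeg M {{nonNegative 0≤M}}
        (*-mono-≤ (0≤ι Δ⁺) (0≤ι (deg⁺ i)) d≤Δ d≤Δ)))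
    where
    q : Vector ℝ n
    q j = ∥ v j ∥²
    d M : ℚ
    d = ι (deg⁺ i)
    M = maxSq v k
    0≤M : 0ℚ ℚ.≤ M
    0≤M = 0≤max (λ j → seq (q j) k)
    d≤Δ : d ℚ.≤ ι Δ⁺
    d≤Δ = ι-mono (x≤⊔ deg⁺ i)

  -- Eigenvectors and a gap between the modulus and the maximum out-degree

  module _ {ρ : ℝ} {μ : ℂ} {v : Vector ℂ n}
    (μρ : IsModulus μ ρ) (Av≈μv : ∀ i → (A *ᵛ v) i ≈ᶜ μ *ᶜ v i) where

    -- The eigenvalue equation turns each row bound into a bound on ρ²|vᵢ|² up to ε. Past a common
    -- threshold it holds for all i at once, hence for the maximum at that index.
    eigen-max-bound : ∀ ε → 0ℚ ℚ.< ε → Eventually λ k →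
        seq ρ k ℚ.* seq ρ k ℚ.* maxSq v k ℚ.≤ ι Δ⁺ ℚ.* ι Δ⁺ ℚ.* maxSq v k ℚ.+ ε
    eigen-max-bound ε 0<ε =
      ev-map (λ k bound → c*max≤ (λ i → seq ∥ v i ∥² k) {seq ρ k ℚ.* seq ρ k}
          (ℚₚ.+-mono-≤ (0≤p*q (0≤p*p (ι Δ⁺)) (0≤max (λ i → seq ∥ v i ∥² k))) (ℚₚ.<⇒≤ 0<ε))
          (λ i → ℚₚ.≤-trans (bound i) (ℚₚ.+-monoˡ-≤ ε (row-max-bound v i k))))
        (ev-∀ λ i → entry i ε 0<ε)
      where
      entry : ∀ i → ρ * ρ * ∥ v i ∥² ≤ fromℕ (deg⁺ i) * ∑ (restrict (out i) (λ j → ∥ v j ∥²))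
      entry i = ≤-trans {ρ * ρ * ∥ v i ∥²} {∥ (A *ᵛ v) i ∥²}
          {fromℕ (deg⁺ i) * ∑ (restrict (out i) (λ j → ∥ v j ∥²))}
        (≈⇒≤ {ρ * ρ * ∥ v i ∥²} {∥ (A *ᵛ v) i ∥²}
          (≈-trans {ρ * ρ * ∥ v i ∥²} {∥ μ ∥² * ∥ v i ∥²} {∥ (A *ᵛ v) i ∥²}
            (*-cong {ρ * ρ} {∥ μ ∥²} {∥ v i ∥²} {∥ v i ∥²} (proj₂ μρ) (≗⇒≈ {∥ v i ∥²} {∥ v i ∥²} λ _ → refl))
            (≈-trans {∥ μ ∥² * ∥ v i ∥²} {∥ μ *ᶜ v i ∥²} {∥ (A *ᵛ v) i ∥²}
              (≈-sym {∥ μ *ᶜ v i ∥²} {∥ μ ∥² * ∥ v i ∥²} (∥∥²-homo-* μ (v i)))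
              (≈-sym {∥ (A *ᵛ v) i ∥²} {∥ μ *ᶜ v i ∥²} (∥∥²-cong {(A *ᵛ v) i} {μ *ᶜ v i} (Av≈μv i))))))
        (row-bound v i)

    -- The assumption to be refuted: `ρ` exceeds `Δ⁺` by a fixed rational gap. It forces the
    -- eigenvector to vanish.
    module _ {η : ℚ} (0<η : 0ℚ ℚ.< η)
      (Δ+η≤ρ : Eventually λ k → ι Δ⁺ ℚ.+ η ℚ.≤ seq ρ k) where

      gap⇒η²maxSq≤ε : ∀ ε → 0ℚ ℚ.< ε → Eventually λ k → η ℚ.* η ℚ.* maxSq v k ℚ.≤ ε
      gap⇒η²maxSq≤ε ε 0<ε = ev-zip
        (λ k gap bound → gap-cancel (0≤ι Δ⁺) 0<η gap (0≤max (λ i → seq ∥ v i ∥² k)) bound)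
        Δ+η≤ρ (eigen-max-bound ε 0<ε)

      gap⇒null : ∀ {s} → (∀ k → s k ℚ.* s k ℚ.≤ maxSq v k) → Null s
      gap⇒null {s} s²≤M ε 0<ε = ev-map small
        -- The tolerance is η²ε²/2: if |sₖ| ≥ ε, then η²ε² ≤ η²Mₖ ≤ η²ε²/2 < η²ε², which is absurd.
        (gap⇒η²maxSq≤ε _ (0<ε/2 0<η²ε²))
        where
        0<η² : 0ℚ ℚ.< η ℚ.* η
        0<η² = 0<p*q 0<η 0<η
        0<η²ε² : 0ℚ ℚ.< η ℚ.* η ℚ.* (ε ℚ.* ε)
        0<η²ε² = 0<p*q 0<η² (0<p*q 0<ε 0<ε)
        half< : η ℚ.* η ℚ.* (ε ℚ.* ε) ℚ.* ½ ℚ.< η ℚ.* η ℚ.* (ε ℚ.* ε)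
        half< = subst₂ ℚ._<_ (ℚₚ.+-identityʳ _) (ε/2+ε/2 _)
          (ℚₚ.+-monoʳ-< (η ℚ.* η ℚ.* (ε ℚ.* ε) ℚ.* ½) (0<ε/2 0<η²ε²))
        small : ∀ k → η ℚ.* η ℚ.* maxSq v k ℚ.≤ η ℚ.* η ℚ.* (ε ℚ.* ε) ℚ.* ½ → ∣ s k ∣ ℚ.< ε
        small k le with ∣ s k ∣ ℚₚ.<? ε
        ... | yes s<ε = s<ε
        ... | no  s≮ε = contradiction
          (ℚₚ.≤-<-trans
            (ℚₚ.≤-trans (ℚₚ.*-monoˡ-≤-nonNeg (η ℚ.* η) {{nonNegative (ℚₚ.<⇒≤ 0<η²)}} ε²≤M) le) half<)
          (ℚₚ.<-irrefl refl)
          where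
          ε²≤M : ε ℚ.* ε ℚ.≤ maxSq v k
          ε²≤M = ℚₚ.≤-trans (*-mono-≤ (ℚₚ.0≤∣p∣ (s k)) (ℚₚ.<⇒≤ 0<ε) (ℚₚ.≮⇒≥ s≮ε) (ℚₚ.≮⇒≥ s≮ε))
            (subst (ℚ._≤ maxSq v k) (sym (∣p∣*∣p∣≡p*p (s k))) (s²≤M k))

      gap⇒zero : ∀ i → v i ≈ᶜ 0ℂ
      gap⇒zero i =
        null-resp (λ k → sym (ℚₚ.+-identityʳ (seq (re (v i)) k))) (gap⇒null
          λ k → ℚₚ.≤-trans (re²≤∥∥² (v i) k) (x≤max (λ i → seq ∥ v i ∥² k) i)) ,
        null-resp (λ k → sym (ℚₚ.+-identityʳ (seq (im (v i)) k))) (gap⇒null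
          λ k → ℚₚ.≤-trans (im²≤∥∥² (v i) k) (x≤max (λ i → seq ∥ v i ∥² k) i))

theorem3p8 : ∀ (n : ℕ) (Φ : GainDigraph n) (ρ : ℝ) →
    IsSpectralRadius (adjacency Φ) ρ → ρ ≤ fromℕ (GainDigraph.Δ⁺ Φ)
theorem3p8 n Φ ρ ((μ , (v , v≉0 , Av≈μv) , μρ) , _) ε 0<ε
  -- Beyond N the sequence of `ρ` moves by less than ε/4, so one decidable comparison of its N-th
  -- term with Δ + ε/2 settles all later terms.
  with cauchy ρ (ε ℚ.* ½ ℚ.* ½) (0<ε/2 (0<ε/2 0<ε))
... | N , close with seq ρ N ℚₚ.≤? ι (GainDigraph.Δ⁺ Φ) ℚ.+ ε ℚ.* ½
... | yes ρ≤ = N , λ k N≤k → begin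
  seq ρ k                                 ≤⟨ ∣p-q∣<ε⇒p≤q+ε (close k N N≤k ℕₚ.≤-refl) ⟩
  seq ρ N ℚ.+ η                           ≤⟨ ℚₚ.+-monoˡ-≤ η ρ≤ ⟩
  -- A spare ε/4 is added so that the total is exactly Δ + ε.
  Δ ℚ.+ ε ℚ.* ½ ℚ.+ η                     ≤⟨ p≤p+η _ ⟩
  Δ ℚ.+ ε ℚ.* ½ ℚ.+ η ℚ.+ η               ≡⟨ solve 2 (λ d e → d :+ e :* con ½ :+ e :* con ½ :* con ½ :+ e :* con ½ :* con ½
                                                          := d :+ e) refl Δ ε ⟩
  Δ ℚ.+ ε                                 ∎
  where
  open ℚₚ.≤-Reasoning
  Δ η : ℚ
  Δ = ι (GainDigraph.Δ⁺ Φ)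
  η = ε ℚ.* ½ ℚ.* ½
  p≤p+η : ∀ p → p ℚ.≤ p ℚ.+ η
  p≤p+η p = subst (ℚ._≤ p ℚ.+ η) (ℚₚ.+-identityʳ p)
    (ℚₚ.+-monoʳ-≤ p (ℚₚ.<⇒≤ (0<ε/2 (0<ε/2 0<ε))))
-- The N-th term exceeds Δ + ε/2, so all later terms are at least Δ + ε/2 - ε/4. This is the gap η =
-- ε/4, which would make the eigenvector zero.
... | no ρ≰ = contradiction
  (gap⇒zero Φ {ρ} {μ} {v} μρ Av≈μv {η} (0<ε/2 (0<ε/2 0<ε)) (N , Δ+η≤ρ)) v≉0
  where
  Δ η : ℚ
  Δ = ι (GainDigraph.Δ⁺ Φ)
  η = ε ℚ.* ½ ℚ.* ½
  Δ+η≤ρ : ∀ k → N ≤ⁿ k → Δ ℚ.+ η ℚ.≤ seq ρ k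
  Δ+η≤ρ k N≤k = subst₂ ℚ._≤_
    (solve 2 (λ d e → (d :+ e :* con ½) :- e :* con ½ :* con ½ := d :+ e :* con ½ :* con ½) refl Δ ε)
    (solve 2 (λ r h → (r :+ h) :- h := r) refl (seq ρ k) η)
    (ℚₚ.+-monoˡ-≤ (ℚ.- η) (ℚₚ.≤-trans (ℚₚ.<⇒≤ (ℚₚ.≰⇒> ρ≰))
      (∣p-q∣<ε⇒p≤q+ε (close N k ℕₚ.≤-refl N≤k))))
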